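{- For $n\ge 1$, let $g_n(\lambda)$ be the characteristic polynomial of the $n\times n$ matrix $G_n$ whose $(p,q)$ entry is $2^{q-p+1}$ if $q\ge p$, $2$ if $q=p-1$, and $0$ if $q<p-1$; and let $g_0(\lambda)=1$. Then for all $n\ge 1$, $$g_{n}(\lambda) = (2-\lambda)g_{n-1}(\lambda) + \sum_{i=2}^{n}(-1)^{i+1}2^{2i-1}g_{n-i}(\lambda).$$
   Context: The characteristic polynomial of an $n\times n$ matrix $G_n$ is $\det(G_n-\lambda I)$. Empty sums are $0$. -}

module Defs where

open import Algebra.Bundles.Raw using (RawRing)
import Algebra.Definitions.RawMonoid as RawMonoidDefs
import Algebra.Definitions.RawSemiring as RawSemiringDefs
open import Data.Bool.Base using (if_then_else_)
open import Data.Fin.Base using (toℕ)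
open import Data.Fin.Patterns using (0F)
import Data.Fin.Properties as Fin
open import Data.Integer.Base as ℤ using (ℤ; +_; 0ℤ; 1ℤ)
open import Data.List.Base using (List; []; _∷_; map)
open import Data.Nat.Base as ℕ using (ℕ; zero; suc; _∸_)
open import Data.Nat.Properties using (_≤?_; _≟_)
open import Data.Vec.Functional using (Vector; tail; removeAt)
open import Level using (0ℓ)
open import Relation.Binary.PropositionalEquality using (_≡_)
open import Relation.Nullary.Decidable.Core using (does)

Matrix : ∀ {a} → Set a → ℕ → ℕ → Set a
Matrix A m n = Vector (Vector A n) m

module _ {c ℓ} (R : RawRing c ℓ) where
  open RawRing R
  open RawMonoidDefs +-rawMonoid using (sum)
  open RawSemiringDefs rawSemiring using (_^_)

  -- f a + f (a + 1) + ⋯ + f b, which is 0# when b < a.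
  sumFromTo : (a b : ℕ) → (ℕ → Carrier) → Carrier
  sumFromTo a b f = sum {suc b ∸ a} λ k → f (a ℕ.+ toℕ k)

  -- Cofactor expansion along the first row.
  det : ∀ {n} → Matrix Carrier n n → Carrier
  det {zero}  M = 1#
  det {suc n} M = sum λ j →
    (- 1#) ^ toℕ j * M 0F j * det (λ i → removeAt (tail M i) j)

-- ℤ[λ]: the list a₀ ∷ a₁ ∷ ⋯ stands for a₀ + a₁λ + ⋯.  Trailing zeros are
-- allowed, so equality of polynomials is _≈_ and not _≡_.
Poly : Set
Poly = List ℤ

coeff : Poly → ℕ → ℤ
coeff []      k       = 0ℤ
coeff (a ∷ p) zero    = a
coeff (a ∷ p) (suc k) = coeff p k

addᴾ : Poly → Poly → Poly
addᴾ []      q       = q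
addᴾ (a ∷ p) []      = a ∷ p
addᴾ (a ∷ p) (b ∷ q) = a ℤ.+ b ∷ addᴾ p q

mulᴾ : Poly → Poly → Poly
mulᴾ []      q = []
mulᴾ (a ∷ p) q = addᴾ (map (a ℤ.*_) q) (0ℤ ∷ mulᴾ p q)

ℤ[λ] : RawRing 0ℓ 0ℓ
ℤ[λ] = record
  { Carrier = Poly
  ; _≈_     = λ p q → ∀ k → coeff p k ≡ coeff q k
  ; _+_     = addᴾ
  ; _*_     = mulᴾ
  ; -_      = map (λ a → ℤ.- a)
  ; 0#      = []
  ; 1#      = 1ℤ ∷ []
  }

open RawRing ℤ[λ] public using (_≈_; _+_; _*_; -_; 0#; 1#)

infixl 6 _-_
_-_ : Poly → Poly → Poly
p - q = p + (- q)

const : ℤ → Poly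
const a = a ∷ []

-- The indeterminate λ.
Λ : Poly
Λ = 0ℤ ∷ 1ℤ ∷ []

identity : ∀ {n} → Matrix Poly n n
identity p q = if does (p Fin.≟ q) then 1# else 0#

charPoly : ∀ {n} → Matrix ℤ n n → Poly
charPoly M = det ℤ[λ] λ p q → const (M p q) - Λ * identity p q

-- Entries depend only on q - p, so indexing from 0 or from 1 is immaterial.
G : ∀ n → Matrix ℤ n n
G n p q =
  if does (toℕ p ≤? toℕ q) then (+ 2) ℤ.^ (toℕ q ∸ toℕ p ℕ.+ 1)
  else if does (toℕ p ≟ toℕ q ℕ.+ 1) then + 2
  else 0ℤ

g : ℕ → Poly
g zero      = 1#
g n@(suc _) = charPoly (G n)

{-# OPTIONS --safe #-}
-- Deleting row 0 and column j of an upper Hessenberg Toeplitz matrix with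
-- constant subdiagonal s leaves a matrix whose first column is s, 0, …, 0 when
-- j > 0.  Peeling off such columns one after another shows that this minor is
-- s ^ j times the determinant of the matrix of the same shape and size n ∸ j.
-- Cofactor expansion along the first row of G n - λ is then the recurrence:
-- i = j + 1, the first row contributes 2 ^ i and the subdiagonal 2 ^ (i - 1).
module Submission where

open import Algebra.Bundles using (Ring)
open import Algebra.Bundles.Raw using (RawRing)
import Algebra.Definitions.RawSemiring as RawSemiringDefs
import Algebra.Properties.Monoid.Sum as MonoidSum
open import Data.Fin.Base using (Fin; zero; suc; toℕ; punchIn)
open import Data.Fin.Patterns using (0F)
open import Data.Integer.Base as ℤ using (ℤ; +_; -1ℤ; 0ℤ; 1ℤ)
import Data.Integer.Properties as ℤ
open import Data.Integer.Tactic.RingSolver using (solve-∀)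
open import Data.List.Base using ([]; _∷_; map)
open import Data.Nat.Base as ℕ using (ℕ; zero; suc; _≤_; _∸_)
import Data.Nat.Properties as ℕ
open import Data.Product.Base using (_,_)
open import Defs
open import Algebra.Structures _≈_ using (IsAbelianGroup; IsRing)
open import Level using (0ℓ)
open import Relation.Binary.PropositionalEquality as ≡
  using (_≡_; refl; sym; trans; cong; cong₂)

-- Determinants over a ring, expanded along the first row.

module Determinant {c ℓ} (R : Ring c ℓ) where
  open Ring R using (Carrier; setoid; rawRing)
    renaming (_≈_ to infix 4 _≈ᴿ_; _+_ to infixl 6 _⊕_; _*_ to infixl 7 _⊗_)
  private module R = Ring R
  open RawSemiringDefs (RawRing.rawSemiring rawRing) using (_^_)
  open MonoidSum R.+-monoid using (sum; sum-cong-≋; sum-replicate-zero)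
  open import Relation.Binary.Reasoning.Setoid setoid

  sum-zero : ∀ {n} (t : Fin n → Carrier) → (∀ j → t j ≈ᴿ R.0#) → sum t ≈ᴿ R.0#
  sum-zero {n} t t≈0 = R.trans (sum-cong-≋ t≈0) (sum-replicate-zero n)

  det-cong : ∀ {n} {M N : Matrix Carrier n n} →
             (∀ i j → M i j ≈ᴿ N i j) → det rawRing M ≈ᴿ det rawRing N
  det-cong {zero}  M≈N = R.refl
  det-cong {suc n} M≈N = sum-cong-≋ λ j →
    R.*-cong (R.*-congˡ {(R.- R.1#) ^ toℕ j} (M≈N 0F j))
             (det-cong λ i k → M≈N (suc i) (punchIn j k))

  -- In the expansion, the term of column 0 contains the zero entry `M 0F 0F`. Every other minor
  -- keeps column 0, because `punchIn (suc j)` fixes `0F`, so it vanishes by induction on the size.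
  det-zeroColumn : ∀ {n} (M : Matrix Carrier (suc n) (suc n)) →
                   (∀ i → M i 0F ≈ᴿ R.0#) → det rawRing M ≈ᴿ R.0#
  det-zeroColumn M M₀≈0 = sum-zero _ (term M M₀≈0)
    where
    term : ∀ {n} (M : Matrix Carrier (suc n) (suc n)) → (∀ i → M i 0F ≈ᴿ R.0#) →
           ∀ j → ((R.- R.1#) ^ toℕ j ⊗ M 0F j)
                 ⊗ det rawRing (λ i k → M (suc i) (punchIn j k)) ≈ᴿ R.0#
    term M M₀≈0 zero = R.trans
      (R.*-congʳ (R.trans (R.*-congˡ (M₀≈0 0F)) (R.zeroʳ _))) (R.zeroˡ _)
    term {suc n} M M₀≈0 (suc j) = R.trans
      (R.*-congˡ (det-zeroColumn (λ i k → M (suc i) (punchIn (suc j) k))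
                                 λ i → M₀≈0 (suc i)))
      (R.zeroʳ _)

  -- This peels off a column although `det` expands along rows: each minor for a column `suc j` has
  -- a zero first column, so only the term of column 0 survives.
  det-firstColumn : ∀ {n} (M : Matrix Carrier (suc n) (suc n)) →
                    (∀ i → M (suc i) 0F ≈ᴿ R.0#) →
                    det rawRing M ≈ᴿ
                    M 0F 0F ⊗ det rawRing (λ i j → M (suc i) (suc j))
  det-firstColumn {zero}  M M₀≈0 = R.trans (R.+-identityʳ _) (R.*-congʳ (R.*-identityˡ _))
  det-firstColumn {suc n} M M₀≈0 = R.trans
    (R.+-cong (R.*-congʳ (R.*-identityˡ _)) (sum-zero {suc n} _ λ j → R.trans
      (R.*-congˡ {(R.- R.1#) ^ suc (toℕ j) ⊗ M 0F (suc j)}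
        (det-zeroColumn (λ i k → M (suc i) (punchIn (suc j) k)) M₀≈0))
      (R.zeroʳ _)))
    (R.+-identityʳ _)

  -- Upper Hessenberg Toeplitz determinants.

  module Hessenberg (s : Carrier) (c : ℕ → Carrier) where

    belowDiagonal : ℕ → Carrier
    belowDiagonal zero    = s
    belowDiagonal (suc p) = R.0#

    -- Stripping one successor from both indices makes the Toeplitz property definitional: deleting
    -- row 0 and column 0 gives the same matrix one size smaller by computation. Natural number
    -- indices keep the entries independent of the size.
    entry : ℕ → ℕ → Carrier
    entry zero    q       = c q
    entry (suc p) zero    = belowDiagonal p
    entry (suc p) (suc q) = entry p q

    D : ℕ → Carrier
    D n = det rawRing {n} λ p q → entry (toℕ p) (toℕ q)

    minor : ∀ n (j : Fin (suc n)) →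
            det rawRing {n} (λ p q → entry (suc (toℕ p)) (toℕ (punchIn j q)))
            ≈ᴿ s ^ toℕ j ⊗ D (n ∸ toℕ j)
    minor n       zero    = R.sym (R.*-identityˡ _)
    minor (suc n) (suc j) = begin
      det rawRing (λ p q → entry (suc (toℕ p)) (toℕ (punchIn (suc j) q)))
        -- Column 0 is still present and, with row 0 gone, reads `s`, 0, ..., 0. What remains after
        -- peeling it off is the minor for column `j` of the matrix one size smaller.
        ≈⟨ det-firstColumn (λ p q → entry (suc (toℕ p)) (toℕ (punchIn (suc j) q)))
             (λ _ → R.refl) ⟩
      s ⊗ det rawRing (λ p q → entry (suc (toℕ p)) (toℕ (punchIn j q)))
        ≈⟨ R.*-congˡ (minor n j) ⟩
      s ⊗ (s ^ toℕ j ⊗ D (n ∸ toℕ j))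
        ≈⟨ R.*-assoc _ _ _ ⟨
      s ^ suc (toℕ j) ⊗ D (n ∸ toℕ j) ∎

    -- Taking any `f` that agrees with `D`, and any closed form `a` of the coefficients, lets the
    -- result be read off directly for `g`. The index `k` stands for column `suc k`, column 0 being
    -- split off.
    D-recurrence : (f a : ℕ → Carrier) → (∀ n → f n ≈ᴿ D n) →
      (∀ k → (R.- R.1#) ^ suc k ⊗ c (suc k) ⊗ s ^ suc k ≈ᴿ a k) →
      ∀ n → f (suc n) ≈ᴿ
        c 0 ⊗ f n ⊕ sum {n} λ k → a (toℕ k) ⊗ f (n ∸ suc (toℕ k))
    D-recurrence f a f≈D a-def n = R.trans (f≈D (suc n)) (R.+-cong
      (R.*-cong (R.*-identityˡ _) (R.sym (f≈D n)))
      (sum-cong-≋ {n} λ k → begin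
        (R.- R.1#) ^ suc (toℕ k) ⊗ c (suc (toℕ k))
        ⊗ det rawRing (λ p q → entry (suc (toℕ p)) (toℕ (punchIn (suc k) q)))
          ≈⟨ R.*-congˡ (minor n (suc k)) ⟩
        (R.- R.1#) ^ suc (toℕ k) ⊗ c (suc (toℕ k))
        ⊗ (s ^ suc (toℕ k) ⊗ D (n ∸ suc (toℕ k)))
          ≈⟨ R.*-assoc _ _ _ ⟨
        (R.- R.1#) ^ suc (toℕ k) ⊗ c (suc (toℕ k)) ⊗ s ^ suc (toℕ k)
        ⊗ D (n ∸ suc (toℕ k))
          ≈⟨ R.*-cong (a-def (toℕ k)) (R.sym (f≈D (n ∸ suc (toℕ k)))) ⟩
        a (toℕ k) ⊗ f (n ∸ suc (toℕ k)) ∎))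

-- Coefficients of polynomials.

coeff-+ : ∀ p q k → coeff (p + q) k ≡ coeff p k ℤ.+ coeff q k
coeff-+ []      q       k       = sym (ℤ.+-identityˡ _)
coeff-+ (a ∷ p) []      k       = sym (ℤ.+-identityʳ _)
coeff-+ (a ∷ p) (b ∷ q) zero    = refl
coeff-+ (a ∷ p) (b ∷ q) (suc k) = coeff-+ p q k

coeff-neg : ∀ p k → coeff (- p) k ≡ ℤ.- coeff p k
coeff-neg []      k       = refl
coeff-neg (a ∷ p) zero    = refl
coeff-neg (a ∷ p) (suc k) = coeff-neg p k

coeff-scale : ∀ a p k → coeff (map (a ℤ.*_) p) k ≡ a ℤ.* coeff p k
coeff-scale a []      k       = sym (ℤ.*-zeroʳ a)
coeff-scale a (b ∷ p) zero    = refl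
coeff-scale a (b ∷ p) (suc k) = coeff-scale a p k

-- Horner form: `a ∷ p` is a + λp, and `0ℤ ∷_` multiplies by λ. The multiplication laws below are
-- proved by induction through this identity.
coeff-∷* : ∀ a p q k →
           coeff ((a ∷ p) * q) k ≡ a ℤ.* coeff q k ℤ.+ coeff (0ℤ ∷ p * q) k
coeff-∷* a p q k = trans (coeff-+ (map (a ℤ.*_) q) (0ℤ ∷ p * q) k)
                         (cong (ℤ._+ _) (coeff-scale a q k))

∷-cong : ∀ {a b} p q → a ≡ b → p ≈ q → a ∷ p ≈ b ∷ q
∷-cong p q a≡b p≈q zero    = a≡b
∷-cong p q a≡b p≈q (suc k) = p≈q k

shift-+ : ∀ p q k → coeff (0ℤ ∷ p + q) k ≡ coeff (0ℤ ∷ p) k ℤ.+ coeff (0ℤ ∷ q) k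
shift-+ p q k = coeff-+ (0ℤ ∷ p) (0ℤ ∷ q) k

shift-scale : ∀ a p k → coeff (0ℤ ∷ map (a ℤ.*_) p) k ≡ a ℤ.* coeff (0ℤ ∷ p) k
shift-scale a p zero    = sym (ℤ.*-zeroʳ a)
shift-scale a p (suc k) = coeff-scale a p k

-- The ring structure of ℤ[λ].

+-isAbelianGroup : IsAbelianGroup _+_ 0# (λ p → - p)
+-isAbelianGroup = record
  { isGroup = record
    { isMonoid = record
      { isSemigroup = record
        { isMagma = record
          { isEquivalence = record
            { refl  = λ k → refl
            ; sym   = λ p≈q k → sym (p≈q k)
            ; trans = λ p≈q q≈r k → trans (p≈q k) (q≈r k)
            }
          ; ∙-cong = λ {p} {p′} {q} {q′} p≈p′ q≈q′ k → begin
              coeff (p + q) k               ≡⟨ coeff-+ p q k ⟩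
              coeff p k ℤ.+ coeff q k       ≡⟨ cong₂ ℤ._+_ (p≈p′ k) (q≈q′ k) ⟩
              coeff p′ k ℤ.+ coeff q′ k     ≡⟨ coeff-+ p′ q′ k ⟨
              coeff (p′ + q′) k             ∎
          }
        ; assoc = λ p q r k → begin
            coeff ((p + q) + r) k                       ≡⟨ coeff-+ (p + q) r k ⟩
            coeff (p + q) k ℤ.+ coeff r k               ≡⟨ cong (ℤ._+ _) (coeff-+ p q k) ⟩
            coeff p k ℤ.+ coeff q k ℤ.+ coeff r k       ≡⟨ ℤ.+-assoc (coeff p k) _ _ ⟩
            coeff p k ℤ.+ (coeff q k ℤ.+ coeff r k)     ≡⟨ cong (λ x → coeff p k ℤ.+ x) (coeff-+ q r k) ⟨
            coeff p k ℤ.+ coeff (q + r) k               ≡⟨ coeff-+ p (q + r) k ⟨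
            coeff (p + (q + r)) k                       ∎
        }
      ; identity = (λ p k → refl)
                 , (λ p k → trans (coeff-+ p [] k) (ℤ.+-identityʳ _))
      }
    ; inverse = (λ p k → trans (coeff-+ (- p) p k)
                  (trans (cong (ℤ._+ coeff p k) (coeff-neg p k)) (ℤ.+-inverseˡ (coeff p k))))
              , (λ p k → trans (coeff-+ p (- p) k)
                  (trans (cong (λ x → coeff p k ℤ.+ x) (coeff-neg p k)) (ℤ.+-inverseʳ (coeff p k))))
    ; ⁻¹-cong = λ {p} {q} p≈q k →
        trans (coeff-neg p k) (trans (cong ℤ.-_ (p≈q k)) (sym (coeff-neg q k)))
    }
  ; comm = λ p q k →
      trans (coeff-+ p q k) (trans (ℤ.+-comm (coeff p k) _) (sym (coeff-+ q p k)))
  }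
  where open ≡.≡-Reasoning

-- A zero polynomial may be a nonempty list of zeros; `*-cong` needs this case when equal
-- polynomials have representatives of different lengths.
*-zeroˡ-≈ : ∀ p q → p ≈ 0# → p * q ≈ 0#
*-zeroˡ-≈ []      q p≈0 k = refl
*-zeroˡ-≈ (a ∷ p) q p≈0 k = trans (coeff-∷* a p q k)
  (cong₂ ℤ._+_ (cong (ℤ._* coeff q k) (p≈0 0)) (shift≈0 k))
  where
  shift≈0 : ∀ k → coeff (0ℤ ∷ p * q) k ≡ 0ℤ
  shift≈0 zero    = refl
  shift≈0 (suc k) = *-zeroˡ-≈ p q (λ i → p≈0 (suc i)) k

*-cong : ∀ p p′ q q′ → p ≈ p′ → q ≈ q′ → p * q ≈ p′ * q′
*-cong []      p′        q q′ p≈p′ q≈q′ k = sym (*-zeroˡ-≈ p′ q′ (λ i → sym (p≈p′ i)) k)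
*-cong (a ∷ p) []        q q′ p≈p′ q≈q′ k = *-zeroˡ-≈ (a ∷ p) q p≈p′ k
*-cong (a ∷ p) (a′ ∷ p′) q q′ p≈p′ q≈q′ k = begin
  coeff ((a ∷ p) * q) k
    ≡⟨ coeff-∷* a p q k ⟩
  a ℤ.* coeff q k ℤ.+ coeff (0ℤ ∷ p * q) k
    ≡⟨ cong₂ ℤ._+_ (cong₂ ℤ._*_ (p≈p′ 0) (q≈q′ k))
         (∷-cong (p * q) (p′ * q′) refl
           (*-cong p p′ q q′ (λ i → p≈p′ (suc i)) q≈q′) k) ⟩
  a′ ℤ.* coeff q′ k ℤ.+ coeff (0ℤ ∷ p′ * q′) k
    ≡⟨ coeff-∷* a′ p′ q′ k ⟨
  coeff ((a′ ∷ p′) * q′) k ∎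
  where open ≡.≡-Reasoning

*-distribʳ-+ : ∀ r p q → (p + q) * r ≈ p * r + q * r
*-distribʳ-+ r []      q       k = refl
*-distribʳ-+ r (a ∷ p) []      k =
  sym (trans (coeff-+ ((a ∷ p) * r) [] k) (ℤ.+-identityʳ _))
*-distribʳ-+ r (a ∷ p) (b ∷ q) k = begin
  coeff ((a ℤ.+ b ∷ p + q) * r) k
    ≡⟨ coeff-∷* (a ℤ.+ b) (p + q) r k ⟩
  (a ℤ.+ b) ℤ.* coeff r k ℤ.+ coeff (0ℤ ∷ (p + q) * r) k
    ≡⟨ cong (λ x → (a ℤ.+ b) ℤ.* coeff r k ℤ.+ x) (trans
         (∷-cong ((p + q) * r) (p * r + q * r) refl (*-distribʳ-+ r p q) k)
         (shift-+ (p * r) (q * r) k)) ⟩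
  (a ℤ.+ b) ℤ.* coeff r k ℤ.+ (coeff (0ℤ ∷ p * r) k ℤ.+ coeff (0ℤ ∷ q * r) k)
    ≡⟨ rearrange a b (coeff r k) _ _ ⟩
  (a ℤ.* coeff r k ℤ.+ coeff (0ℤ ∷ p * r) k) ℤ.+ (b ℤ.* coeff r k ℤ.+ coeff (0ℤ ∷ q * r) k)
    ≡⟨ cong₂ ℤ._+_ (coeff-∷* a p r k) (coeff-∷* b q r k) ⟨
  coeff ((a ∷ p) * r) k ℤ.+ coeff ((b ∷ q) * r) k
    ≡⟨ coeff-+ ((a ∷ p) * r) ((b ∷ q) * r) k ⟨
  coeff ((a ∷ p) * r + (b ∷ q) * r) k ∎
  where
  open ≡.≡-Reasoning
  rearrange : ∀ a b x y z → (a ℤ.+ b) ℤ.* x ℤ.+ (y ℤ.+ z) ≡ (a ℤ.* x ℤ.+ y) ℤ.+ (b ℤ.* x ℤ.+ z)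
  rearrange = solve-∀

*-distribˡ-+ : ∀ p q r → p * (q + r) ≈ p * q + p * r
*-distribˡ-+ []      q r k = refl
*-distribˡ-+ (a ∷ p) q r k = begin
  coeff ((a ∷ p) * (q + r)) k
    ≡⟨ coeff-∷* a p (q + r) k ⟩
  a ℤ.* coeff (q + r) k ℤ.+ coeff (0ℤ ∷ p * (q + r)) k
    ≡⟨ cong₂ (λ x y → a ℤ.* x ℤ.+ y) (coeff-+ q r k) (trans
         (∷-cong (p * (q + r)) (p * q + p * r) refl (*-distribˡ-+ p q r) k)
         (shift-+ (p * q) (p * r) k)) ⟩
  a ℤ.* (coeff q k ℤ.+ coeff r k) ℤ.+ (coeff (0ℤ ∷ p * q) k ℤ.+ coeff (0ℤ ∷ p * r) k)
    ≡⟨ rearrange a (coeff q k) (coeff r k) _ _ ⟩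
  (a ℤ.* coeff q k ℤ.+ coeff (0ℤ ∷ p * q) k) ℤ.+ (a ℤ.* coeff r k ℤ.+ coeff (0ℤ ∷ p * r) k)
    ≡⟨ cong₂ ℤ._+_ (coeff-∷* a p q k) (coeff-∷* a p r k) ⟨
  coeff ((a ∷ p) * q) k ℤ.+ coeff ((a ∷ p) * r) k
    ≡⟨ coeff-+ ((a ∷ p) * q) ((a ∷ p) * r) k ⟨
  coeff ((a ∷ p) * q + (a ∷ p) * r) k ∎
  where
  open ≡.≡-Reasoning
  rearrange : ∀ a x y u v → a ℤ.* (x ℤ.+ y) ℤ.+ (u ℤ.+ v) ≡ (a ℤ.* x ℤ.+ u) ℤ.+ (a ℤ.* y ℤ.+ v)
  rearrange = solve-∀

scale-* : ∀ a q r → map (a ℤ.*_) q * r ≈ map (a ℤ.*_) (q * r)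
scale-* a []      r k = refl
scale-* a (b ∷ q) r k = begin
  coeff ((a ℤ.* b ∷ map (a ℤ.*_) q) * r) k
    ≡⟨ coeff-∷* (a ℤ.* b) (map (a ℤ.*_) q) r k ⟩
  a ℤ.* b ℤ.* coeff r k ℤ.+ coeff (0ℤ ∷ map (a ℤ.*_) q * r) k
    ≡⟨ cong (λ x → a ℤ.* b ℤ.* coeff r k ℤ.+ x) (trans
         (∷-cong (map (a ℤ.*_) q * r) (map (a ℤ.*_) (q * r)) refl (scale-* a q r) k)
         (shift-scale a (q * r) k)) ⟩
  a ℤ.* b ℤ.* coeff r k ℤ.+ a ℤ.* coeff (0ℤ ∷ q * r) k
    ≡⟨ rearrange a b (coeff r k) _ ⟩
  a ℤ.* (b ℤ.* coeff r k ℤ.+ coeff (0ℤ ∷ q * r) k)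
    ≡⟨ cong (a ℤ.*_) (coeff-∷* b q r k) ⟨
  a ℤ.* coeff ((b ∷ q) * r) k
    ≡⟨ coeff-scale a ((b ∷ q) * r) k ⟨
  coeff (map (a ℤ.*_) ((b ∷ q) * r)) k ∎
  where
  open ≡.≡-Reasoning
  rearrange : ∀ a b x y → a ℤ.* b ℤ.* x ℤ.+ a ℤ.* y ≡ a ℤ.* (b ℤ.* x ℤ.+ y)
  rearrange = solve-∀

shift-* : ∀ p q → (0ℤ ∷ p) * q ≈ 0ℤ ∷ p * q
shift-* p q k = trans (coeff-∷* 0ℤ p q k) (ℤ.+-identityˡ _)

-- Right distributivity splits (a + λp)q into its scaled and shifted parts; multiplication by `r`
-- commutes with scaling and with the shift, and induction handles `p`.
*-assoc : ∀ p q r → (p * q) * r ≈ p * (q * r)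
*-assoc []      q r k = refl
*-assoc (a ∷ p) q r k = begin
  coeff ((map (a ℤ.*_) q + (0ℤ ∷ p * q)) * r) k
    ≡⟨ *-distribʳ-+ r (map (a ℤ.*_) q) (0ℤ ∷ p * q) k ⟩
  coeff (map (a ℤ.*_) q * r + (0ℤ ∷ p * q) * r) k
    ≡⟨ coeff-+ (map (a ℤ.*_) q * r) ((0ℤ ∷ p * q) * r) k ⟩
  coeff (map (a ℤ.*_) q * r) k ℤ.+ coeff ((0ℤ ∷ p * q) * r) k
    ≡⟨ cong₂ ℤ._+_ (scale-* a q r k) (trans (shift-* (p * q) r k)
         (∷-cong ((p * q) * r) (p * (q * r)) refl (*-assoc p q r) k)) ⟩
  coeff (map (a ℤ.*_) (q * r)) k ℤ.+ coeff (0ℤ ∷ p * (q * r)) k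
    ≡⟨ coeff-+ (map (a ℤ.*_) (q * r)) (0ℤ ∷ p * (q * r)) k ⟨
  coeff ((a ∷ p) * (q * r)) k ∎
  where open ≡.≡-Reasoning

*-identityˡ : ∀ p → 1# * p ≈ p
*-identityˡ p k = trans (coeff-∷* 1ℤ [] p k)
  (trans (cong₂ ℤ._+_ (ℤ.*-identityˡ (coeff p k)) (0∷[]≈0 k)) (ℤ.+-identityʳ _))
  where
  0∷[]≈0 : ∀ k → coeff (0ℤ ∷ []) k ≡ 0ℤ
  0∷[]≈0 zero    = refl
  0∷[]≈0 (suc k) = refl

*-identityʳ : ∀ p → p * 1# ≈ p
*-identityʳ []      k       = refl
*-identityʳ (a ∷ p) zero    = trans (ℤ.+-identityʳ _) (ℤ.*-identityʳ a)
*-identityʳ (a ∷ p) (suc k) = *-identityʳ p k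

isRing : IsRing _+_ _*_ (λ p → - p) 0# 1#
isRing = record
  { +-isAbelianGroup = +-isAbelianGroup
  ; *-cong           = λ {p} {p′} {q} {q′} → *-cong p p′ q q′
  ; *-assoc          = *-assoc
  ; *-identity       = *-identityˡ , *-identityʳ
  ; distrib          = *-distribˡ-+ , *-distribʳ-+
  }

polyRing : Ring 0ℓ 0ℓ
polyRing = record { isRing = isRing }

-- The characteristic matrix of `G` and its recurrence.

open Determinant polyRing using (det-cong; module Hessenberg)
open RawSemiringDefs (RawRing.rawSemiring ℤ[λ]) using (_^_)

const-* : ∀ a b → const a * const b ≡ const (a ℤ.* b)
const-* a b = cong const (ℤ.+-identityʳ (a ℤ.* b))

const-^ : ∀ a n → const a ^ n ≡ const (a ℤ.^ n)
const-^ a zero    = refl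
const-^ a (suc n) = trans (cong (const a *_) (const-^ a n)) (const-* a (a ℤ.^ n))

row : ℕ → Poly
row zero    = const (+ 2) - Λ
row (suc k) = const ((+ 2) ℤ.^ suc (suc k))

open Hessenberg (const (+ 2)) row using (entry; D; D-recurrence)

charEntry : ∀ {n} (p q : Fin n) →
            const (G n p q) - Λ * identity p q ≈ entry (toℕ p) (toℕ q)
charEntry 0F             0F       k             = refl
-- Off the diagonal `Λ * 0#` evaluates to a list of two zeros instead of `[]`, so coefficients 0, 1
-- and the rest are compared separately.
charEntry 0F             (suc q)  zero          =
  trans (ℤ.+-identityʳ _) (cong (λ m → (+ 2) ℤ.^ suc m) (ℕ.+-comm (toℕ q) 1))
charEntry 0F             (suc q)  (suc zero)    = refl
charEntry 0F             (suc q)  (suc (suc k)) = refl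
charEntry (suc zero)     0F       zero          = refl
charEntry (suc zero)     0F       (suc zero)    = refl
charEntry (suc zero)     0F       (suc (suc k)) = refl
charEntry (suc (suc p))  0F       zero          = refl
charEntry (suc (suc p))  0F       (suc zero)    = refl
charEntry (suc (suc p))  0F       (suc (suc k)) = refl
-- Both sides depend only on the difference of the indices. The row is split once more so that the
-- comparisons in `G` compute.
charEntry (suc zero)     (suc q)  k             = charEntry zero q k
charEntry (suc (suc p))  (suc q)  k             = charEntry (suc p) q k

g≈D : ∀ n → g n ≈ D n
g≈D zero    k = refl
g≈D (suc n) = det-cong {M = λ p q → const (G (suc n) p q) - Λ * identity p q}
                       {λ p q → entry (toℕ p) (toℕ q)} charEntry

-- Here i = k + 2. Products and powers of constants stay one-element lists, so the equality is
-- strict and reduces to integers.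
coefficient : ∀ k →
  (- 1#) ^ suc k * row (suc k) * const (+ 2) ^ suc k ≡
  const (-1ℤ ℤ.^ (2 ℕ.+ k ℕ.+ 1) ℤ.* (+ 2) ℤ.^ (2 ℕ.* (2 ℕ.+ k) ∸ 1))
coefficient k = begin
  const -1ℤ ^ suc k * const (two^ (2 ℕ.+ k)) * const (+ 2) ^ suc k
    ≡⟨ cong₂ (λ x y → x * row (suc k) * y) (const-^ -1ℤ (suc k)) (const-^ (+ 2) (suc k)) ⟩
  const (sign (suc k)) * const (two^ (2 ℕ.+ k)) * const (two^ (suc k))
    ≡⟨ trans (cong (_* const (two^ (suc k))) (const-* (sign (suc k)) (two^ (2 ℕ.+ k))))
         (const-* (sign (suc k) ℤ.* two^ (2 ℕ.+ k)) (two^ (suc k))) ⟩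
  const (sign (suc k) ℤ.* two^ (2 ℕ.+ k) ℤ.* two^ (suc k))
    -- Two extra factors -1 raise the sign exponent from k + 1 to i + 1 = k + 3.
    ≡⟨ cong const (rearrange (-1ℤ ℤ.^ k) (two^ (2 ℕ.+ k)) (two^ (suc k))) ⟩
  const (sign (3 ℕ.+ k) ℤ.* (two^ (suc k) ℤ.* two^ (2 ℕ.+ k)))
    ≡⟨ cong₂ (λ m x → const (sign m ℤ.* x)) (ℕ.+-comm 1 (2 ℕ.+ k))
         (sym (ℤ.^-distribˡ-+-* (+ 2) (suc k) (2 ℕ.+ k))) ⟩
  const (sign (2 ℕ.+ k ℕ.+ 1) ℤ.* two^ (suc k ℕ.+ (2 ℕ.+ k)))
    ≡⟨ cong (λ m → const (sign (2 ℕ.+ k ℕ.+ 1) ℤ.* two^ m)) exponent ⟩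
  const (sign (2 ℕ.+ k ℕ.+ 1) ℤ.* two^ (2 ℕ.* (2 ℕ.+ k) ∸ 1)) ∎
  where
  open ≡.≡-Reasoning
  sign two^ : ℕ → ℤ
  sign = -1ℤ ℤ.^_
  two^ = (+ 2) ℤ.^_
  exponent : suc k ℕ.+ (2 ℕ.+ k) ≡ 2 ℕ.* (2 ℕ.+ k) ∸ 1
  exponent = cong (suc k ℕ.+_) (sym (ℕ.+-identityʳ (2 ℕ.+ k)))
  rearrange : ∀ e a b → (-1ℤ ℤ.* e) ℤ.* a ℤ.* b ≡ (-1ℤ ℤ.* (-1ℤ ℤ.* (-1ℤ ℤ.* e))) ℤ.* (b ℤ.* a)
  rearrange = solve-∀

corollary3 : (n : ℕ) → 1 ≤ n →
    g n ≈ (const (+ 2) - Λ) * g (n ∸ 1)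
          + sumFromTo ℤ[λ] 2 n (λ i →
              const (-1ℤ ℤ.^ (i ℕ.+ 1) ℤ.* (+ 2) ℤ.^ (2 ℕ.* i ∸ 1)) * g (n ∸ i))
-- With i = 2 + k, the sum from 2 to `suc n` has `n` terms and `suc n ∸ i` is `n ∸ suc k`, both by
-- computation.
corollary3 (suc n) _ = D-recurrence g
  (λ k → const (-1ℤ ℤ.^ (2 ℕ.+ k ℕ.+ 1) ℤ.* (+ 2) ℤ.^ (2 ℕ.* (2 ℕ.+ k) ∸ 1)))
  g≈D (λ k → Ring.reflexive polyRing (coefficient k)) n
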